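{- Assume Markov's principle, and assume that for all sets $A$ and $B$ which both have the $\neg\neg$ strong Myhill property, either $A + B$ or $A \times B$ has the $\neg\neg$ Myhill property. Then excluded middle holds (i.e. $p \vee \neg p$ for every $p \in \Omega$).
   Context: The statement is to be proved constructively (intuitionistic set theory with powersets and $\mathbb{N}$, equivalently the internal logic of a topos with natural numbers object; neither excluded middle nor choice is assumed). $\Omega = \mathcal{P}(1)$ is the set of truth values; $+$ is disjoint union. Markov's principle: for every $p \in 2^{\mathbb{N}}$, if $p \neq 0^\omega$ (the constant $0$ sequence), then there exists $n$ with $p_n = 1$. A subset $A \subseteq X$ is $\neg\neg$-stable if for all $x \in X$, $\neg\neg(x \in A)$ implies $x \in A$. A set $X$ has the $\neg\neg$ Myhill property if for all $\neg\neg$-stable subsets $A, B \subseteq X$: if there are injections $f, g : X \to X$ with $A = f^{ -1}(B)$ and $B = g^{ -1}(A)$, then there is a bijection $h : X \to X$ which restricts to a bijection between $A$ and $B$. For injections $f, g : X \to X$ and $m \in \mathbb{Z}$, let $R^{f,g}_m \subseteq X \times X$ be the partial injection $f \circ (g \circ f)^m$: for $m \ge 0$, $(x,y) \in R^{f,g}_m$ iff $y = f((g\circ f)^m(x))$; for $m < 0$, $(x,y) \in R^{f,g}_m$ iff $x = g((f \circ g)^{ -m-1}(y))$. A set $X$ has the $\neg\neg$ strong Myhill property if for every pair of injections $f, g : X \to X$ there is a bijection $h : X \to X$ such that for every $x \in X$, $\neg\neg\, \exists m \in \mathbb{Z}.\ (x,h(x)) \in R^{f,g}_m$. -}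

-- Sets are setoids, truth values are types up to logical equivalence
-- (propositions-as-types), and a subset of X is a predicate on the carrier
-- that respects the equality of X.

module Defs where

open import Data.Bool.Base using (Bool; true; false)
open import Data.Integer.Base using (ℤ; +_; -[1+_])
open import Data.Nat.Base using (ℕ)
open import Data.Nat.GeneralisedArithmetic using (fold)
open import Data.Product.Base using (Σ; ∃; ∃-syntax; _,_; proj₁)
open import Function.Base using (_∘_; const; _on_)
open import Function.Bundles using (Injection; Bijection)
open import Function.Definitions using (Bijective)
open import Level using (Level; _⊔_; suc)
open import Relation.Binary.Bundles using (Setoid)
open import Relation.Binary.Definitions using (_Respects_)
open import Relation.Binary.PropositionalEquality using (_≡_; _≗_)
open import Relation.Nullary using (¬_)
open import Relation.Unary using (Pred; Stable; _∈_; _≐_)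

private
  variable
    c ℓ : Level

-- Equality in 2^ℕ is pointwise.

MarkovsPrinciple : Set
MarkovsPrinciple =
  (p : ℕ → Bool) → ¬ (p ≗ const false) → ∃[ n ] p n ≡ true

module _ (X : Setoid c ℓ) where

  open Setoid X using (Carrier; _≈_)

  record StableSubset : Set (c ⊔ suc ℓ) where
    field
      pred     : Pred Carrier ℓ
      respects : pred Respects _≈_
      stable   : Stable pred

  RestrictsToBijection : (Carrier → Carrier) →
                         Pred Carrier ℓ → Pred Carrier ℓ → Set (c ⊔ ℓ)
  RestrictsToBijection h A B =
    Σ (∀ x → x ∈ A → h x ∈ B) λ h[A]⊆B →
      Bijective {A = ∃ A} {B = ∃ B} (_≈_ on proj₁) (_≈_ on proj₁)
        (λ (x , x∈A) → h x , h[A]⊆B x x∈A)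

  ¬¬Myhill : Set (c ⊔ suc ℓ)
  ¬¬Myhill =
    (A B : StableSubset) (f g : Injection X X) →
    let open StableSubset
        module f = Injection f
        module g = Injection g
    in
    pred A ≐ pred B ∘ f.to →
    pred B ≐ pred A ∘ g.to →
    Σ (Bijection X X) λ h →
      RestrictsToBijection (Bijection.to h) (pred A) (pred B)

  -- R f g m x y : (x , y) is in the graph of the partial injection
  -- f ∘ (g ∘ f)ᵐ.  Since -[1+ k ] denotes m = - (k + 1), the exponent
  -- - m - 1 of the negative case is k.

  R : (f g : Injection X X) → ℤ → Carrier → Carrier → Set ℓ
  R f g = graph
    where
    module f = Injection f
    module g = Injection g

    graph : ℤ → Carrier → Carrier → Set ℓ
    graph (+ m)    x y = y ≈ f.to (fold x (g.to ∘ f.to) m)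
    graph -[1+ k ] x y = x ≈ g.to (fold y (f.to ∘ g.to) k)

  ¬¬StrongMyhill : Set (c ⊔ ℓ)
  ¬¬StrongMyhill =
    (f g : Injection X X) →
    Σ (Bijection X X) λ h →
      ∀ x → ¬ ¬ (∃[ m ] R f g m x (Bijection.to h x))

{-# OPTIONS --safe #-}

-- Fix P and let Maybe P have all proofs of P identified.  Every injection of
-- Maybe P into itself is a bijection, so Maybe P has the strong Myhill property;
-- by Markov's principle so does ℕ∞.  Both in Maybe P + ℕ∞ and in Maybe P × ℕ∞
-- there are mutually reducible A and B such that A lies in a copy of ℕ∞, while
-- if P holds then B has a point over "just".  If h is a bijection that maps A
-- onto B, then P is equivalent to the existence of x ∈ ℕ∞ whose image under h
-- lies over "just", which is decidable because ℕ∞ is omniscient.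
--
-- For the strong Myhill property of ℕ∞, let f and g be injections and let L say
-- that f ∞ or g ∞ is finite.  L makes ∞ an isolated point, and if L fails then
-- f ∞ = g ∞ = ∞.  So f and g restrict to K = {finite points} ∪ {∞ | L}, which is
-- discrete and enumerable; the back-and-forth construction yields a bijection
-- of K, and this extends to ℕ∞.

module Submission where

open import Defs
open import Axiom.ExcludedMiddle using (ExcludedMiddle)
open import Data.Bool.Base using (Bool; false; T)
open import Data.Bool.Properties using (T-≡; T?)
open import Data.Empty.Polymorphic using (⊥)
open import Data.Integer.Base using (+_; -[1+_])
open import Data.List.Base using (List; []; _∷_; map; filter; length)
open import Data.List.Membership.Propositional using (find; lose)
  renaming (_∈_ to _∈ˡ_)
open import Data.List.Membership.Propositional.Properties
  using (∈-map⁺; ∈-map⁻; ∈-filter⁺; ∈-filter⁻)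
open import Data.List.Properties using (filter-notAll)
open import Data.List.Relation.Binary.Subset.Propositional using ()
  renaming (_⊆_ to _⊆ˡ_)
open import Data.List.Relation.Unary.Any using (here; there; any?)
open import Data.Maybe.Base using (just; nothing)
import Data.Maybe.Relation.Binary.Pointwise as Maybe
open import Data.Nat.Base
  using (ℕ; zero; suc; _+_; _≤_; _<_; _≤′_; ≤′-reflexive; ≤′-step; parity)
  renaming (_⊔_ to _⊔ℕ_)
open import Data.Nat.GeneralisedArithmetic using (fold; fold-+)
open import Data.Nat.Induction using (Acc; acc; <-wellFounded; <-rec)
open import Data.Nat.Properties
  using (+-comm; ≤⇒≤′; m≤m⊔n; m≤n⊔m; <-cmp; allUpTo?)
  renaming (_≟_ to _≟ℕ_)
open import Data.Parity.Base using (0ℙ)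
import Data.Parity.Properties as Parity
open import Data.Product.Base
  using (Σ; ∃; ∃-syntax; _×_; _,_; proj₁; proj₂; swap)
open import Data.Product.Relation.Binary.Pointwise.NonDependent using (_×ₛ_)
open import Data.Sum.Base using (_⊎_; inj₁; inj₂; [_,_])
open import Data.Sum.Relation.Binary.Pointwise using (_⊎ₛ_)
import Data.Sum.Relation.Binary.Pointwise as ⊎
open import Data.Unit.Polymorphic using (⊤; tt)
open import Function.Base using (_∘_; flip; id; const)
open import Function.Bundles
  using (Injection; Bijection; Inverse; Func; Equivalence)
import Function.Construct.Symmetry as Symmetry
open import Function.Properties.Inverse using (Inverse⇒Bijection)
open import Level using (Level; _⊔_)
open import Relation.Binary.Bundles using (Setoid; DecSetoid)
import Relation.Binary.Construct.Always as Always
open import Relation.Binary.Core using (Rel)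
open import Relation.Binary.Definitions using (_Respects_; tri<; tri≈; tri>)
open import Relation.Binary.PropositionalEquality as ≡
  using (_≡_; refl; cong; subst)
import Relation.Binary.Reasoning.Setoid as ≈-Reasoning
open import Relation.Nullary
  using (¬_; Dec; yes; no; ¬?; contradiction; decidable-stable)
open import Relation.Nullary.Decidable
  using (map′; ⌊_⌋; toWitness; fromWitness; _×-dec_; _⊎-dec_)
open import Relation.Unary using (Pred; Decidable)

private
  variable
    c ℓ r : Level

-- Orbits of a pair of injections.

module Orbit (X : Setoid c ℓ) (f g : Injection X X) where

  open Setoid X using (Carrier; _≈_; sym; trans)
    renaming (refl to ≈-refl; reflexive to ≡⇒≈)
  open ≈-Reasoning X

  private
    module f = Injection f
    module g = Injection g

  step : Carrier → Carrier
  step = g.to ∘ f.to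

  steps : ℕ → Carrier → Carrier
  steps n x = fold x step n

  steps-cong : ∀ n {x y} → x ≈ y → steps n x ≈ steps n y
  steps-cong zero    x≈y = x≈y
  steps-cong (suc n) x≈y = g.cong (f.cong (steps-cong n x≈y))

  steps-comm : ∀ m n x → steps m (steps n x) ≈ steps n (steps m x)
  steps-comm m n x = begin
    steps m (steps n x)  ≡⟨ fold-+ x step m ⟨
    steps (m + n) x      ≡⟨ cong (λ k → steps k x) (+-comm m n) ⟩
    steps (n + m) x      ≡⟨ fold-+ x step n ⟩
    steps n (steps m x)  ∎

  steps-swap : ∀ n y → steps n (g.to y) ≡ g.to (fold y (f.to ∘ g.to) n)
  steps-swap zero    y = refl
  steps-swap (suc n) y = cong step (steps-swap n y)

  infix 4 _~_

  -- Asking that forward orbits meet expresses the two-sided orbit relation of the injection `step`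
  -- without negative iterates.
  _~_ : Rel Carrier ℓ
  x ~ y = ∃[ m ] ∃[ n ] steps m x ≈ steps n y

  ~-reflexive : ∀ {x y} → x ≈ y → x ~ y
  ~-reflexive x≈y = 0 , 0 , x≈y

  ~-sym : ∀ {x y} → x ~ y → y ~ x
  ~-sym (m , n , eq) = n , m , sym eq

  ~-trans : ∀ {x y z} → x ~ y → y ~ z → x ~ z
  ~-trans {x} {y} {z} (m , n , x~y) (k , l , y~z) = k + m , n + l , (begin
    steps (k + m) x      ≡⟨ fold-+ x step k ⟩
    steps k (steps m x)  ≈⟨ steps-cong k x~y ⟩
    steps k (steps n y)  ≈⟨ steps-comm k n y ⟩
    steps n (steps k y)  ≈⟨ steps-cong n y~z ⟩
    steps n (steps l z)  ≡⟨ fold-+ z step n ⟨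
    steps (n + l) z      ∎)

  -- ∃[ m ] R X f g m x y says that x and y lie on a common chain
  -- … x ↦ f x ↦ g (f x) ↦ …; applying g moves y into the domain side.
  Connected : Rel Carrier ℓ
  Connected x y = x ~ g.to y

  connected-f : ∀ {x y} → f.to x ≈ y → Connected x y
  connected-f fx≈y = 1 , 0 , g.cong fx≈y

  connected-g : ∀ {x y} → g.to y ≈ x → Connected x y
  connected-g gy≈x = ~-reflexive (sym gy≈x)

  -- Difunctionality. Together with `connected-f` and `connected-g` it is all that the
  -- back-and-forth construction knows about this relation.
  zigzag : ∀ {x y a z} → Connected x y → Connected a y → Connected a z →
           Connected x z
  zigzag x~y a~y a~z = ~-trans x~y (~-trans (~-sym a~y) a~z)

  -- Injectivity of f and g cancels common steps until one side has none left; which side runs out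
  -- first determines the sign of m.
  connected⇒R : ∀ {x y} → Connected x y → ∃[ m ] R X f g m x y
  connected⇒R (m , n , eq) = cancel m n eq
    where
    cancel : ∀ m n {x y} → steps m x ≈ steps n (g.to y) → ∃[ i ] R X f g i x y
    cancel zero    n {y = y} eq = -[1+ n ] , trans eq (≡⇒≈ (steps-swap n y))
    cancel (suc m) zero      eq = + m , sym (g.injective eq)
    cancel (suc m) (suc n)   eq = cancel m n (f.injective (g.injective eq))

  R-resp : ∀ m {x x′ y y′} → x ≈ x′ → y ≈ y′ → R X f g m x y → R X f g m x′ y′
  R-resp (+ m) x≈x′ y≈y′ eq =
    trans (sym y≈y′) (trans eq (f.cong (steps-cong m x≈x′)))
  R-resp -[1+ n ] {x} {x′} {y} {y′} x≈x′ y≈y′ eq = begin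
    x′                                ≈⟨ x≈x′ ⟨
    x                                 ≈⟨ eq ⟩
    g.to (fold y (f.to ∘ g.to) n)     ≡⟨ steps-swap n y ⟨
    steps n (g.to y)                  ≈⟨ steps-cong n (g.cong y≈y′) ⟩
    steps n (g.to y′)                 ≡⟨ steps-swap n y′ ⟩
    g.to (fold y′ (f.to ∘ g.to) n)    ∎

-- Finite partial bijections and back-and-forth.

module Matchings (K : DecSetoid c ℓ) where

  open DecSetoid K renaming (refl to ≈-refl) hiding (_≉_)

  -- A finite partial bijection inside `D`. As a list it has decidable domain and range, and its
  -- length is the measure for the chase below.
  record Matching (D : Rel Carrier r) : Set (c ⊔ ℓ ⊔ r) where
    field
      pairs      : List (Carrier × Carrier)
      functional : ∀ {p q} → p ∈ˡ pairs → q ∈ˡ pairs →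
                   proj₁ p ≈ proj₁ q → proj₂ p ≈ proj₂ q
      injective  : ∀ {p q} → p ∈ˡ pairs → q ∈ˡ pairs →
                   proj₂ p ≈ proj₂ q → proj₁ p ≈ proj₁ q
      related    : ∀ {p} → p ∈ˡ pairs → D (proj₁ p) (proj₂ p)

  open Matching public

  empty : {D : Rel Carrier r} → Matching D
  empty = record
    { pairs = [] ; functional = λ () ; injective = λ () ; related = λ () }

  converse : {D : Rel Carrier r} → Matching D → Matching (flip D)
  converse M = record
    { pairs      = map swap (pairs M)
    ; functional = λ p q → case (∈-map⁻ swap p) (∈-map⁻ swap q) (injective M)
    ; injective  = λ p q → case (∈-map⁻ swap p) (∈-map⁻ swap q) (functional M)
    ; related    = λ p → related′ (∈-map⁻ swap p)
    }
    where
    case : ∀ {p q} {Q : Carrier × Carrier → Carrier × Carrier → Set ℓ} →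
           ∃ (λ p′ → p′ ∈ˡ pairs M × p ≡ swap p′) →
           ∃ (λ q′ → q′ ∈ˡ pairs M × q ≡ swap q′) →
           (∀ {p′ q′} → p′ ∈ˡ pairs M → q′ ∈ˡ pairs M → Q (swap p′) (swap q′)) →
           Q p q
    case (_ , p∈ , refl) (_ , q∈ , refl) k = k p∈ q∈

    related′ : ∀ {p} → ∃ (λ p′ → p′ ∈ˡ pairs M × p ≡ swap p′) → _
    related′ (_ , p∈ , refl) = related M p∈

  InDomain InRange : List (Carrier × Carrier) → Carrier → Set (c ⊔ ℓ)
  InDomain ps x = ∃ λ p → p ∈ˡ ps × proj₁ p ≈ x
  InRange  ps y = ∃ λ p → p ∈ˡ ps × proj₂ p ≈ y

  inDomain? : ∀ ps x → Dec (InDomain ps x)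
  inDomain? ps x with any? (λ p → proj₁ p ≟ x) ps
  ... | yes p = yes (find p)
  ... | no ¬p = no λ (_ , p∈ , eq) → ¬p (lose p∈ eq)

  inRange? : ∀ ps y → Dec (InRange ps y)
  inRange? ps y with any? (λ p → proj₂ p ≟ y) ps
  ... | yes p = yes (find p)
  ... | no ¬p = no λ (_ , p∈ , eq) → ¬p (lose p∈ eq)

  endsElsewhere? : ∀ b (p : Carrier × Carrier) → Dec (¬ proj₂ p ≈ b)
  endsElsewhere? b p = ¬? (proj₂ p ≟ b)

  module Chase (f : Injection setoid setoid) {D : Rel Carrier r}
    (D-f    : ∀ {x y} → Injection.to f x ≈ y → D x y)
    (zigzag : ∀ {x y a z} → D x y → D a y → D a z → D x z) where

    private
      module f = Injection f

    -- If f x is already taken, by a, restart from a with that pair removed.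
    fresh : ∀ M → Acc _<_ (length (pairs {D = D} M)) → ∀ x →
            ¬ InDomain (pairs M) x →
            ∃ λ a → (x ≈ a ⊎ InDomain (pairs M) a) ×
                    ¬ InRange (pairs M) (f.to a) × D x (f.to a)
    fresh M (acc rs) x x∉ with inRange? (pairs M) (f.to x)
    ... | no ¬taken = x , inj₁ ≈-refl , ¬taken , D-f ≈-refl
    ... | yes ((a , b) , ab∈ , b≈fx)
      with fresh rest
             (rs (filter-notAll (endsElsewhere? b) (pairs M)
                   (lose ab∈ λ ¬b≈b → ¬b≈b ≈-refl)))
             -- Every pair starting at a ends at b, hence was removed, so a is unmatched in `rest`.
             a (λ (p , p∈ , p≈a) → let p∈M , p≉b = rest⁻ p∈ in
                                   p≉b (functional M p∈M ab∈ p≈a))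
      where
      rest⁻ : ∀ {p} → p ∈ˡ filter (endsElsewhere? b) (pairs M) →
              p ∈ˡ pairs M × ¬ proj₂ p ≈ b
      rest⁻ = ∈-filter⁻ (endsElsewhere? b)

      rest : Matching D
      rest = record
        { pairs      = filter (endsElsewhere? b) (pairs M)
        ; functional = λ p q → functional M (proj₁ (rest⁻ p)) (proj₁ (rest⁻ q))
        ; injective  = λ p q → injective M (proj₁ (rest⁻ p)) (proj₁ (rest⁻ q))
        ; related    = λ p → related M (proj₁ (rest⁻ p))
        }
    ... | a′ , a′-origin , fa′∉rest , D-a-fa′ =
      -- The zigzag runs from x to b, back to a, and on to `f.to a′`.
      a′ , inj₂ a′∈M , fa′∉M , zigzag (D-f (sym b≈fx)) (related M ab∈) D-a-fa′
      where
      a′∈M : InDomain (pairs M) a′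
      a′∈M = [ (λ a≈a′ → (a , b) , ab∈ , a≈a′)
             , (λ (p , p∈ , eq) → p , proj₁ (∈-filter⁻ (endsElsewhere? b) p∈) , eq)
             ] a′-origin

      fa′∉M : ¬ InRange (pairs M) (f.to a′)
      fa′∉M (q , q∈ , q≈fa′) with proj₂ q ≟ b
      ... | no q≉b  = fa′∉rest (q , ∈-filter⁺ (endsElsewhere? b) q∈ q≉b , q≈fa′)
      -- Here `f.to a′` equals b and so `f.to x`; then a′ equals x, yet a′ lies in the domain of `M`
      -- and x does not.
      ... | yes q≈b =
        let p , p∈ , p≈a′ = a′∈M
            fa′≈fx = trans (sym q≈fa′) (trans q≈b b≈fx)
        in x∉ (p , p∈ , trans p≈a′ (f.injective fa′≈fx))

    cons : ∀ M {x y} → ¬ InDomain (pairs M) x → ¬ InRange (pairs M) y → D x y →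
           Matching D
    cons M {x} {y} x∉ y∉ Dxy = record
      { pairs      = (x , y) ∷ pairs M
      ; functional = functional′
      ; injective  = injective′
      ; related    = λ { (here refl) → Dxy ; (there p∈) → related M p∈ }
      }
      where
      functional′ : ∀ {p q} → p ∈ˡ (x , y) ∷ pairs M → q ∈ˡ (x , y) ∷ pairs M →
                    proj₁ p ≈ proj₁ q → proj₂ p ≈ proj₂ q
      functional′ (here refl) (here refl) _  = ≈-refl
      functional′ (here refl) (there q)   eq = contradiction (_ , q , sym eq) x∉
      functional′ (there p)   (here refl) eq = contradiction (_ , p , eq) x∉
      functional′ (there p)   (there q)   eq = functional M p q eq

      injective′ : ∀ {p q} → p ∈ˡ (x , y) ∷ pairs M → q ∈ˡ (x , y) ∷ pairs M →
                   proj₂ p ≈ proj₂ q → proj₁ p ≈ proj₁ q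
      injective′ (here refl) (here refl) _  = ≈-refl
      injective′ (here refl) (there q)   eq = contradiction (_ , q , sym eq) y∉
      injective′ (there p)   (here refl) eq = contradiction (_ , p , eq) y∉
      injective′ (there p)   (there q)   eq = injective M p q eq

    -- The chase only finds a free value related to x. The old pairs stay untouched, so that the
    -- stages increase and their union is a function.
    extend : ∀ M x → ∃ λ M′ → pairs M ⊆ˡ pairs {D = D} M′ × InDomain (pairs M′) x
    extend M x with inDomain? (pairs M) x
    ... | yes x∈ = M , id , x∈
    ... | no  x∉ with fresh M (<-wellFounded _) x x∉
    ...   | a , _ , fa∉ , Dxfa =
      cons M x∉ fa∉ Dxfa , there , (_ , here refl , ≈-refl)

  module BackAndForth {r}
    (enum : ℕ → Carrier) (enum-surjective : ∀ a → ∃[ n ] enum n ≈ a)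
    (f g : Injection setoid setoid) (D : Rel Carrier r)
    (D-f    : ∀ {x y} → Injection.to f x ≈ y → D x y)
    (D-g    : ∀ {x y} → Injection.to g y ≈ x → D x y)
    (zigzag : ∀ {x y a z} → D x y → D a y → D a z → D x z) where

    private
      module Forth = Chase f {D} D-f zigzag
      -- A zigzag read backwards is a zigzag for the converse relation, so the same chase serves
      -- both directions.
      module Back  = Chase g {flip D} D-g (λ Dyx Dya Dza → zigzag Dza Dya Dyx)

    extendBoth : (M : Matching D) (x : Carrier) → ∃ λ M′ →
                 pairs M ⊆ˡ pairs {D = D} M′ ×
                 InDomain (pairs M′) x × InRange (pairs M′) x
    extendBoth M x with Forth.extend M x
    ... | M₁ , M⊆M₁ , (p , p∈ , p≈x) with Back.extend (converse M₁) x
    ...   | M₂ , M₁⊆M₂ , (q , q∈ , q≈x) =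
      converse M₂ , mono ∘ M⊆M₁ , (p , mono p∈ , p≈x) , (swap q , ∈-map⁺ swap q∈ , q≈x)
      where
      mono : pairs M₁ ⊆ˡ pairs (converse M₂)
      mono = ∈-map⁺ swap ∘ M₁⊆M₂ ∘ ∈-map⁺ swap

    stage : ℕ → Matching D
    stage zero    = empty
    stage (suc n) = proj₁ (extendBoth (stage n) (enum n))

    stage-mono : ∀ {m n} → m ≤ n → pairs (stage m) ⊆ˡ pairs (stage n)
    stage-mono = mono ∘ ≤⇒≤′
      where
      mono : ∀ {m n} → m ≤′ n → pairs (stage m) ⊆ˡ pairs (stage n)
      mono (≤′-reflexive refl) = id
      mono (≤′-step {n} m≤n)   =
        proj₁ (proj₂ (extendBoth (stage n) (enum n))) ∘ mono m≤n

    Graph : Carrier → Carrier → Set _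
    Graph a b = ∃ λ n → ∃ λ p → p ∈ˡ pairs (stage n) × proj₁ p ≈ a × proj₂ p ≈ b

    Graph-functional : ∀ {a b a′ b′} → Graph a b → Graph a′ b′ → a ≈ a′ → b ≈ b′
    Graph-functional (m , p , p∈ , p≈a , p≈b) (n , q , q∈ , q≈a′ , q≈b′) a≈a′ =
      trans (sym p≈b) (trans
        (functional (stage (m ⊔ℕ n))
          (stage-mono (m≤m⊔n m n) p∈) (stage-mono (m≤n⊔m m n) q∈)
          (trans p≈a (trans a≈a′ (sym q≈a′))))
        q≈b′)

    Graph-injective : ∀ {a b a′ b′} → Graph a b → Graph a′ b′ → b ≈ b′ → a ≈ a′
    Graph-injective (m , p , p∈ , p≈a , p≈b) (n , q , q∈ , q≈a′ , q≈b′) b≈b′ =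
      trans (sym p≈a) (trans
        (injective (stage (m ⊔ℕ n))
          (stage-mono (m≤m⊔n m n) p∈) (stage-mono (m≤n⊔m m n) q∈)
          (trans p≈b (trans b≈b′ (sym q≈b′))))
        q≈a′)

    image : ∀ a → ∃ λ b → Graph a b × D a b
    image a with enum-surjective a
    ... | n , enum≈a =
      let _ , _ , (p , p∈ , p≈enum) , _ = extendBoth (stage n) (enum n)
          p≈a = trans p≈enum enum≈a
      in proj₂ p , (suc n , p , p∈ , p≈a , ≈-refl) ,
         -- The zigzag through the image of a under f carries relatedness from `proj₁ p` over to the
         -- equal point a.
         zigzag (D-f ≈-refl) (D-f (Injection.cong f p≈a)) (related (stage (suc n)) p∈)

    preimage : ∀ b → ∃ λ a → Graph a b
    preimage b with enum-surjective b
    ... | n , enum≈b =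
      let _ , _ , _ , (p , p∈ , p≈enum) = extendBoth (stage n) (enum n)
      in proj₁ p , suc n , p , p∈ , ≈-refl , trans p≈enum enum≈b

    opaque
      back-and-forth : Σ (Inverse setoid setoid) λ h → ∀ a → D a (Inverse.to h a)
      back-and-forth = h , λ a → proj₂ (proj₂ (image a))
        where
        to-graph : ∀ a → Graph a (proj₁ (image a))
        to-graph a = proj₁ (proj₂ (image a))

        from-graph : ∀ b → Graph (proj₁ (preimage b)) b
        from-graph b = proj₂ (preimage b)

        h : Inverse setoid setoid
        h = record
          { to        = proj₁ ∘ image
          ; from      = proj₁ ∘ preimage
          ; to-cong   = Graph-functional (to-graph _) (to-graph _)
          ; from-cong = Graph-injective (from-graph _) (from-graph _)
          ; inverse   = Graph-functional (to-graph _) (from-graph _)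
                      , Graph-injective (from-graph _) (to-graph _)
          }

-- Conatural numbers.

-- Represents the conatural number n by the sequence with a single 1 at n,
-- and ∞ by 0^ω.
record ℕ∞ ℓ : Set ℓ where
  field
    digit  : ℕ → Bool
    unique : ∀ {i j} → T (digit i) → T (digit j) → i ≡ j

open ℕ∞

module _ {ℓ : Level} where

  infix 4 _∋_ _≈_

  -- The record wrapper raises the proposition to level ℓ, so that ℕ∞ is a setoid at the level of
  -- the theorem.
  record _∋_ (x : ℕ∞ ℓ) (n : ℕ) : Set ℓ where
    constructor mk∋
    field
      holds : T (digit x n)

  record _≈_ (x y : ℕ∞ ℓ) : Set ℓ where
    constructor mk≈
    field
      ⇒ : ∀ {n} → x ∋ n → y ∋ n
      ⇐ : ∀ {n} → y ∋ n → x ∋ n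

  open _≈_ public

  _∋?_ : ∀ x n → Dec (x ∋ n)
  x ∋? n = map′ mk∋ _∋_.holds (T? (digit x n))

  ∋-unique : ∀ {x i j} → x ∋ i → x ∋ j → i ≡ j
  ∋-unique {x} (mk∋ xᵢ) (mk∋ xⱼ) = unique x xᵢ xⱼ

  ≈-refl : ∀ {x} → x ≈ x
  ≈-refl = mk≈ id id

  ≈-sym : ∀ {x y} → x ≈ y → y ≈ x
  ≈-sym (mk≈ p q) = mk≈ q p

  ≈-trans : ∀ {x y z} → x ≈ y → y ≈ z → x ≈ z
  ≈-trans (mk≈ p q) (mk≈ p′ q′) = mk≈ (p′ ∘ p) (q ∘ q′)

  module _ {q} {Q : Pred ℕ q} (Q? : Decidable Q)
    (Q-unique : ∀ {i j} → Q i → Q j → i ≡ j) where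

    indicator : ℕ∞ ℓ
    indicator = record
      { digit  = λ n → ⌊ Q? n ⌋
      ; unique = λ p q → Q-unique (toWitness p) (toWitness q)
      }

    indicator⁺ : ∀ {n} → Q n → indicator ∋ n
    indicator⁺ = mk∋ ∘ fromWitness

    indicator⁻ : ∀ {n} → indicator ∋ n → Q n
    indicator⁻ (mk∋ p) = toWitness p

  fin : ℕ → ℕ∞ ℓ
  fin n = record
    { digit  = λ k → ⌊ n ≟ℕ k ⌋
    ; unique = λ p q → ≡.trans (≡.sym (toWitness p)) (toWitness q)
    }

  fin∋ : ∀ {n} → fin n ∋ n
  fin∋ {n} = mk∋ (fromWitness {a? = n ≟ℕ n} refl)

  fin∋⇒≡ : ∀ {n k} → fin n ∋ k → n ≡ k
  fin∋⇒≡ {n} {k} (mk∋ p) = toWitness {a? = n ≟ℕ k} p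

  ∋⇒≈fin : ∀ {x n} → x ∋ n → x ≈ fin n
  ∋⇒≈fin {x} {n} xₙ = mk≈
    (λ xₖ → subst (fin n ∋_) (∋-unique xₙ xₖ) fin∋)
    (λ p → subst (x ∋_) (fin∋⇒≡ p) xₙ)

  ≈fin⇒∋ : ∀ {x n} → x ≈ fin n → x ∋ n
  ≈fin⇒∋ x≈n = ⇐ x≈n fin∋

  ∞ : ℕ∞ ℓ
  ∞ = record { digit = const false ; unique = λ () }

  ∞∌ : ∀ {n} → ¬ ∞ ∋ n
  ∞∌ (mk∋ ())

  ∌⇒≈∞ : ∀ {x} → (∀ n → ¬ x ∋ n) → x ≈ ∞
  ∌⇒≈∞ x∌ = mk≈ (λ xₙ → contradiction xₙ (x∌ _)) (λ ∞ₙ → contradiction ∞ₙ ∞∌)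

ℕ∞ₛ : ∀ ℓ → Setoid ℓ ℓ
ℕ∞ₛ ℓ = record
  { Carrier       = ℕ∞ ℓ
  ; _≈_           = _≈_
  ; isEquivalence = record { refl = ≈-refl ; sym = ≈-sym ; trans = ≈-trans }
  }

-- Searching in ℕ∞ and in ℕ.

-- Escardó's argument: Q is inhabited iff it holds at the least n with Q (fin n),
-- read as ∞ when there is none.
omniscience : ∀ {ℓ q} {Q : Pred (ℕ∞ ℓ) q} → Q Respects _≈_ → Decidable Q →
              Dec (∃ Q)
omniscience {Q = Q} Q-resp Q? =
  map′ (x₀ ,_) (λ (x , Qx) → decidable-stable (Q? x₀) (least x Qx)) (Q? x₀)
  where
  First : Pred ℕ _
  First n = Q (fin n) × (∀ {i} → i < n → ¬ Q (fin i))

  first? : Decidable First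
  first? n = Q? (fin n) ×-dec allUpTo? (λ i → ¬? (Q? (fin i))) n

  first-unique : ∀ {i j} → First i → First j → i ≡ j
  first-unique {i} {j} (Qi , i-least) (Qj , j-least) with <-cmp i j
  ... | tri< i<j _ _ = contradiction Qi (j-least i<j)
  ... | tri≈ _ i≡j _ = i≡j
  ... | tri> _ _ j<i = contradiction Qj (i-least j<i)

  x₀ : ℕ∞ _
  x₀ = indicator first? first-unique

  -- If `Q x₀` fails, no finite point satisfies `Q`, since the first such point would be `x₀`. Then
  -- x and `x₀` are both ∞, and `Q x` gives `Q x₀`.
  least : ∀ x → Q x → ¬ ¬ Q x₀
  least x Qx ¬Qx₀ = ¬Qx₀ (Q-resp (≈-trans x≈∞ (≈-sym x₀≈∞)) Qx)
    where
    ¬Q-fin : ∀ n → ¬ Q (fin n)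
    ¬Q-fin = <-rec _ λ n ¬Q< Qn →
      let x₀∋n = indicator⁺ first? first-unique (Qn , λ i<n → ¬Q< i<n)
      in ¬Qx₀ (Q-resp (≈-sym (∋⇒≈fin x₀∋n)) Qn)

    x≈∞ : x ≈ ∞
    x≈∞ = ∌⇒≈∞ λ n xₙ → ¬Q-fin n (Q-resp (∋⇒≈fin xₙ) Qx)

    x₀≈∞ : x₀ ≈ ∞
    x₀≈∞ = ∌⇒≈∞ λ n p → ¬Q-fin n (proj₁ (indicator⁻ first? first-unique p))

markov : MarkovsPrinciple → ∀ {q} {Q : Pred ℕ q} → Decidable Q →
         ¬ (∀ n → ¬ Q n) → ∃ Q
markov mp Q? ¬∀¬Q =
  let n , eq = mp (λ n → ⌊ Q? n ⌋) λ all-false → ¬∀¬Q λ n Qn →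
                 subst T (all-false n) (fromWitness {a? = Q? n} Qn)
  in n , toWitness (Equivalence.from T-≡ eq)

interleave : ∀ {a} {A : Set a} → (ℕ → A) → (ℕ → A) → ℕ → A
interleave s t zero    = s zero
interleave s t (suc n) = interleave t (s ∘ suc) n

interleave-left : ∀ {a} {A : Set a} (s t : ℕ → A) n → ∃[ m ] interleave s t m ≡ s n
interleave-left s t zero    = 0 , refl
interleave-left s t (suc n) =
  let m , eq = interleave-left (s ∘ suc) (t ∘ suc) n in suc (suc m) , eq

interleave-right : ∀ {a} {A : Set a} (s t : ℕ → A) n → ∃[ m ] interleave s t m ≡ t n
interleave-right s t n =
  let m , eq = interleave-left t (s ∘ suc) n in suc m , eq

-- Extending bijections from a discrete part to ℕ∞.

-- The points of ℕ∞ that are finite, or equal to ∞ in case L.  They form a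
-- decidable set because L makes ∞ an isolated point, hence ℕ∞ discrete.
module Located {ℓ} (L : Set ℓ)
  (classify : L → (x : ℕ∞ ℓ) → (∃ λ n → x ∋ n) ⊎ x ≈ ∞) where

  K : Set ℓ
  K = ℕ ⊎ L

  point : K → ℕ∞ ℓ
  point = [ fin , const ∞ ]

  infix 4 _≈ᴷ_

  -- Pulling equality back along `point` identifies all proofs of `L`.
  _≈ᴷ_ : Rel K ℓ
  a ≈ᴷ b = point a ≈ point b

  locate : L → ∀ x → ∃ λ a → x ≈ point a
  locate l x with classify l x
  ... | inj₁ (n , xₙ) = inj₁ n , ∋⇒≈fin xₙ
  ... | inj₂ x≈∞      = inj₂ l , x≈∞

  -- One digit tests for a finite point, while ∞ comes with a proof of `L`, which classifies x.
  -- Allowing every x in ℕ∞ is what lets `extend` compute digits outside `K`.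
  _≈?_ : ∀ x a → Dec (x ≈ point a)
  x ≈? inj₁ n = map′ ∋⇒≈fin ≈fin⇒∋ (x ∋? n)
  x ≈? inj₂ l with classify l x
  ... | inj₁ (n , xₙ) = no λ x≈∞ → ∞∌ (⇒ x≈∞ xₙ)
  ... | inj₂ x≈∞      = yes x≈∞

  Kₛ : DecSetoid ℓ ℓ
  Kₛ = record
    { Carrier          = K
    ; _≈_              = _≈ᴷ_
    ; isDecEquivalence = record
      { isEquivalence = record { refl = ≈-refl ; sym = ≈-sym ; trans = ≈-trans }
      ; _≟_           = λ a b → point a ≈? b
      }
    }

  open DecSetoid Kₛ using (setoid) public

  restrict : (f : Injection (ℕ∞ₛ ℓ) (ℕ∞ₛ ℓ)) →
             (∀ a → ∃ λ b → Injection.to f (point a) ≈ point b) →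
             Injection setoid setoid
  restrict f stays = record
    { to        = proj₁ ∘ stays
    ; cong      = λ {a} {b} a≈b →
        ≈-trans (≈-sym (proj₂ (stays a))) (≈-trans (f.cong a≈b) (proj₂ (stays b)))
    ; injective = λ {a} {b} eq →
        f.injective (≈-trans (proj₂ (stays a)) (≈-trans eq (≈-sym (proj₂ (stays b)))))
    }
    where
    module f = Injection f

  -- (extend h x) has k-th digit ⌊ x ≈ h⁻¹ k ⌋, which is meaningful also for
  -- those x that are not known to be in K.
  module _ (h : Inverse setoid setoid) where

    private
      module h = Inverse h

    preimage-unique : ∀ {x i j} → x ≈ point (h.from (inj₁ i)) →
                      x ≈ point (h.from (inj₁ j)) → i ≡ j
    preimage-unique {_} {i} {j} xᵢ xⱼ = ∋-unique fin∋ (≈fin⇒∋ i≈j)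
      where
      i≈j : inj₁ i ≈ᴷ inj₁ j
      i≈j = ≈-trans (≈-sym (h.strictlyInverseˡ (inj₁ i))) (h.inverseˡ (≈-trans (≈-sym xᵢ) xⱼ))

    extend : ℕ∞ ℓ → ℕ∞ ℓ
    extend x = indicator (λ k → x ≈? h.from (inj₁ k)) preimage-unique

    extend⁺ : ∀ {x k} → x ≈ point (h.from (inj₁ k)) → extend x ∋ k
    extend⁺ {x} = indicator⁺ (λ k → x ≈? h.from (inj₁ k)) preimage-unique

    extend⁻ : ∀ {x k} → extend x ∋ k → x ≈ point (h.from (inj₁ k))
    extend⁻ {x} = indicator⁻ (λ k → x ≈? h.from (inj₁ k)) preimage-unique

    extend-cong : ∀ {x y} → x ≈ y → extend x ≈ extend y
    extend-cong x≈y = mk≈ (λ p → extend⁺ (≈-trans (≈-sym x≈y) (extend⁻ p)))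
                          (λ p → extend⁺ (≈-trans x≈y (extend⁻ p)))

    extend-point : ∀ {x a} → x ≈ point a → extend x ≈ point (h.to a)
    extend-point {x} {a} x≈a = mk≈
      (λ p → ≈fin⇒∋ (h.inverseˡ (≈-trans (≈-sym x≈a) (extend⁻ p))))
      (λ p → extend⁺ (≈-trans x≈a (≈-sym (h.inverseʳ (≈-sym (∋⇒≈fin p))))))

    -- If `h.to a` is finite, the corresponding digit of `extend x` names the preimage. If it is ∞
    -- there is no digit to read, but its proof of `L` locates x in `K`, where h is injective.
    extend-reflects : ∀ {x a} → extend x ≈ point (h.to a) → x ≈ point a
    extend-reflects {x} {a} eq with h.to a in to-a
    ... | inj₁ k = ≈-trans (extend⁻ (≈fin⇒∋ eq))
                     (h.inverseʳ (subst (λ b → inj₁ k ≈ᴷ b) (≡.sym to-a) ≈-refl))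
    ... | inj₂ l =
      let b , x≈b = locate l x
          to-b≈to-a = subst (λ c → h.to b ≈ᴷ c) (≡.sym to-a)
                        (≈-trans (≈-sym (extend-point x≈b)) eq)
      in ≈-trans x≈b (≈-trans (≈-sym (h.strictlyInverseʳ b)) (h.inverseʳ to-b≈to-a))

  -- The n-th digit on the left tests whether `extend h x` is the image of n, which by the two
  -- preceding lemmas means that x is n.
  extend-inverse : ∀ h x → extend (Symmetry.inverse h) (extend h x) ≈ x
  extend-inverse h x = mk≈
    (λ p → ≈fin⇒∋ (extend-reflects h (extend⁻ (Symmetry.inverse h) p)))
    (λ xₙ → extend⁺ (Symmetry.inverse h) (extend-point h (∋⇒≈fin xₙ)))

  extension : Inverse setoid setoid → Inverse (ℕ∞ₛ ℓ) (ℕ∞ₛ ℓ)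
  extension h = record
    { to        = extend h
    ; from      = extend h⁻¹
    ; to-cong   = extend-cong h
    ; from-cong = extend-cong h⁻¹
    ; inverse   = (λ y≈ → ≈-trans (extend-cong h y≈) (extend-inverse h⁻¹ _))
                , (λ x≈ → ≈-trans (extend-cong h⁻¹ x≈) (extend-inverse h _))
    }
    where
    h⁻¹ = Symmetry.inverse h

-- The strong Myhill property of ℕ∞.

module _ (mp : MarkovsPrinciple) {ℓ : Level} where

  -- By injectivity x is ∞ exactly when f x has digit k, which is decidable; if x is not ∞, Markov's
  -- principle finds its digit.
  finite∞⇒classify : (f : Injection (ℕ∞ₛ ℓ) (ℕ∞ₛ ℓ)) →
    ∀ {k} → Injection.to f ∞ ∋ k → ∀ x → (∃ λ n → x ∋ n) ⊎ x ≈ ∞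
  finite∞⇒classify f {k} f∞ₖ x with Injection.to f x ∋? k
  ... | yes fxₖ = inj₂ (Injection.injective f
                         (≈-trans (∋⇒≈fin fxₖ) (≈-sym (∋⇒≈fin f∞ₖ))))
  ... | no ¬fxₖ = inj₁ (markov mp (x ∋?_) λ x∌ →
                    ¬fxₖ (⇐ (Injection.cong f (∌⇒≈∞ x∌)) f∞ₖ))

  -- If neither had a digit, f x and f ∞ would both be ∞ and x would be ∞ by injectivity. This keeps
  -- f inside `K` at finite points.
  finite-or-finite∞ : (f : Injection (ℕ∞ₛ ℓ) (ℕ∞ₛ ℓ)) → ∀ {x n} → x ∋ n →
    ∃ λ k → Injection.to f x ∋ k ⊎ Injection.to f ∞ ∋ k
  finite-or-finite∞ f {x} xₙ =
    markov mp (λ k → (f.to x ∋? k) ⊎-dec (f.to ∞ ∋? k)) λ none →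
      ∞∌ (⇒ (f.injective (≈-trans (∌⇒≈∞ λ k → none k ∘ inj₁)
                           (≈-sym (∌⇒≈∞ λ k → none k ∘ inj₂)))) xₙ)
    where
    module f = Injection f

  ℕ∞-strongMyhill : ¬¬StrongMyhill (ℕ∞ₛ ℓ)
  ℕ∞-strongMyhill f g = Inverse⇒Bijection h , h-related
    where
    module f = Injection f
    module g = Injection g
    open Orbit (ℕ∞ₛ ℓ) f g

    L : Set ℓ
    L = ∃ λ k → f.to ∞ ∋ k ⊎ g.to ∞ ∋ k

    classify : L → ∀ x → (∃ λ n → x ∋ n) ⊎ x ≈ ∞
    classify (_ , inj₁ f∞ₖ) = finite∞⇒classify f f∞ₖ
    classify (_ , inj₂ g∞ₖ) = finite∞⇒classify g g∞ₖ

    open Located L classify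

    stays : (j : Injection (ℕ∞ₛ ℓ) (ℕ∞ₛ ℓ)) → (∀ {k} → Injection.to j ∞ ∋ k → L) →
            ∀ a → ∃ λ b → Injection.to j (point a) ≈ point b
    stays j j∞⇒L (inj₂ l) = locate l _
    stays j j∞⇒L (inj₁ n) with finite-or-finite∞ j {fin n} fin∋
    ... | k , inj₁ jnₖ = inj₁ k , ∋⇒≈fin jnₖ
    ... | k , inj₂ j∞ₖ = locate (j∞⇒L j∞ₖ) _

    f-stays = stays f (λ p → _ , inj₁ p)
    g-stays = stays g (λ p → _ , inj₂ p)

    L? : ∀ k → Dec (f.to ∞ ∋ k ⊎ g.to ∞ ∋ k)
    L? k = (f.to ∞ ∋? k) ⊎-dec (g.to ∞ ∋? k)

    infinite : ℕ → K
    infinite k with L? k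
    ... | yes p = inj₂ (k , p)
    -- A harmless repetition of 0 when k does not witness `L`.
    ... | no  _ = inj₁ 0

    infinite-L : ∀ k → f.to ∞ ∋ k ⊎ g.to ∞ ∋ k → point (infinite k) ≡ ∞
    infinite-L k p with L? k
    ... | yes _ = refl
    ... | no ¬p = contradiction p ¬p

    enum : ℕ → K
    enum = interleave inj₁ infinite

    enum-surjective : ∀ a → ∃[ n ] enum n ≈ᴷ a
    enum-surjective (inj₁ n) =
      let m , eq = interleave-left inj₁ infinite n
      in m , subst (λ b → b ≈ᴷ inj₁ n) (≡.sym eq) ≈-refl
    enum-surjective (inj₂ (k , p)) =
      let m , eq = interleave-right inj₁ infinite k
      in m , subst (_≈ ∞) (≡.sym (≡.trans (cong point eq) (infinite-L k p))) ≈-refl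

    bijectionᴷ : Σ (Inverse setoid setoid) λ h →
                 ∀ a → Connected (point a) (point (Inverse.to h a))
    bijectionᴷ = Matchings.BackAndForth.back-and-forth Kₛ enum enum-surjective
      (restrict f f-stays) (restrict g g-stays)
      (λ a b → Connected (point a) (point b))
      (λ {a} eq → connected-f (≈-trans (proj₂ (f-stays a)) eq))
      (λ {_} {b} eq → connected-g (≈-trans (proj₂ (g-stays b)) eq))
      zigzag

    hᴷ = proj₁ bijectionᴷ

    h : Inverse (ℕ∞ₛ ℓ) (ℕ∞ₛ ℓ)
    h = extension hᴷ

    -- Points of `K` are related to their images by construction. A point unrelated to its image is
    -- thus outside `K`, which forces it, its image and its value under f all to be ∞; but then m =
    -- 0 relates them.
    h-related : ∀ x → ¬ ¬ (∃[ m ] R (ℕ∞ₛ ℓ) f g m x (Inverse.to h x))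
    h-related x unrelated = unrelated (+ 0 , ≈-trans hx≈∞ (≈-sym fx≈∞))
      where
      x∉K : ∀ a → ¬ x ≈ point a
      x∉K a x≈a =
        let m , r = connected⇒R (proj₂ bijectionᴷ a)
        in unrelated (m , R-resp m (≈-sym x≈a)
                            (≈-sym (extend-point hᴷ x≈a)) r)

      x≈∞ : x ≈ ∞
      x≈∞ = ∌⇒≈∞ λ n → x∉K (inj₁ n) ∘ ∋⇒≈fin

      hx≈∞ : Inverse.to h x ≈ ∞
      hx≈∞ = ∌⇒≈∞ λ k → x∉K (Inverse.from hᴷ (inj₁ k)) ∘ extend⁻ hᴷ

      fx≈∞ : f.to x ≈ ∞
      fx≈∞ = ∌⇒≈∞ λ k fxₖ → x∉K (inj₂ (k , inj₁ (⇒ (f.cong x≈∞) fxₖ))) x≈∞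

-- Shift and parity on ℕ∞.

module _ {ℓ : Level} where

  1+ : ℕ∞ ℓ → ℕ∞ ℓ
  1+ x = record
    { digit  = λ { zero → false ; (suc n) → digit x n }
    ; unique = λ { {suc i} {suc j} p q → cong suc (unique x p q) }
    }

  1+⁺ : ∀ {x n} → x ∋ n → 1+ x ∋ suc n
  1+⁺ (mk∋ xₙ) = mk∋ xₙ

  1+⁻ : ∀ {x n} → 1+ x ∋ suc n → x ∋ n
  1+⁻ (mk∋ xₙ) = mk∋ xₙ

  1+∌0 : ∀ {x} → ¬ 1+ x ∋ 0
  1+∌0 (mk∋ ())

  1+-cong : ∀ {x y} → x ≈ y → 1+ x ≈ 1+ y
  1+-cong x≈y = mk≈ (λ { {zero} p → contradiction p 1+∌0 ; {suc n} p → 1+⁺ (⇒ x≈y (1+⁻ p)) })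
                    (λ { {zero} p → contradiction p 1+∌0 ; {suc n} p → 1+⁺ (⇐ x≈y (1+⁻ p)) })

  1+-injective : ∀ {x y} → 1+ x ≈ 1+ y → x ≈ y
  1+-injective eq = mk≈ (λ p → 1+⁻ (⇒ eq (1+⁺ p))) (λ p → 1+⁻ (⇐ eq (1+⁺ p)))

  -- Quantifying over digits makes ∞ even and the predicate ¬¬-stable.
  Even : Pred (ℕ∞ ℓ) ℓ
  Even x = ∀ n → x ∋ n → parity n ≡ 0ℙ

  Even-resp : ∀ {x y} → x ≈ y → Even x → Even y
  Even-resp x≈y even n yₙ = even n (⇐ x≈y yₙ)

  Even-stable : ∀ x → ¬ ¬ Even x → Even x
  Even-stable x ¬¬even n xₙ =
    decidable-stable (parity n Parity.≟ 0ℙ) λ ≢0 → ¬¬even λ even → ≢0 (even n xₙ)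

  Even-2+⁺ : ∀ {x} → Even x → Even (1+ (1+ x))
  Even-2+⁺ even zero          p = refl
  Even-2+⁺ even (suc zero)    p = contradiction (1+⁻ p) 1+∌0
  Even-2+⁺ even (suc (suc n)) p = even n (1+⁻ (1+⁻ p))

  Even-2+⁻ : ∀ {x} → Even (1+ (1+ x)) → Even x
  Even-2+⁻ even n p = even (suc (suc n)) (1+⁺ (1+⁺ p))

  Even-fin0 : Even (fin 0)
  Even-fin0 n p with refl ← fin∋⇒≡ p = refl

  ¬Even-fin1 : ¬ Even (fin 1)
  ¬Even-fin1 even with () ← even 1 fin∋

  -- The setoid `Maybe P` and the decision of P.

  module _ (P : Set ℓ) where

    Maybeₛ : Setoid ℓ ℓ
    Maybeₛ = Maybe.setoid (Always.setoid P ℓ)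

    open Setoid Maybeₛ using ()
      renaming (_≈_ to _≈ₘ_; refl to reflₘ; sym to symₘ; trans to transₘ)

    -- A value `just p` of f, or a target `just p`, supplies the proof that makes `just p` available
    -- as an argument; f is then an injection of a two-element set.
    Maybe-injection-surjective : (f : Injection Maybeₛ Maybeₛ) →
      ∀ y → ∃ λ x → Injection.to f x ≈ₘ y
    Maybe-injection-surjective f nothing with Injection.to f nothing in f-nothing
    ... | nothing = nothing , subst (_≈ₘ nothing) (≡.sym f-nothing) reflₘ
    ... | just p with Injection.to f (just p) in f-just
    ...   | nothing = just p , subst (_≈ₘ nothing) (≡.sym f-just) reflₘ
    ...   | just q with () ← Injection.injective f {nothing} {just p}
                      (≡.subst₂ _≈ₘ_ (≡.sym f-nothing) (≡.sym f-just) (Maybe.just tt))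
    Maybe-injection-surjective f (just p) with Injection.to f (just p) in f-just
    ... | just q  = just p , subst (_≈ₘ just p) (≡.sym f-just) (Maybe.just tt)
    ... | nothing with Injection.to f nothing in f-nothing
    ...   | just q  = nothing , subst (_≈ₘ just p) (≡.sym f-nothing) (Maybe.just tt)
    ...   | nothing with () ← Injection.injective f {nothing} {just p}
                      (≡.subst₂ _≈ₘ_ (≡.sym f-nothing) (≡.sym f-just) Maybe.nothing)

    Maybe-strongMyhill : ¬¬StrongMyhill Maybeₛ
    Maybe-strongMyhill f g = h , λ x unrelated → unrelated (+ 0 , reflₘ)
      where
      module f = Injection f

      h : Bijection Maybeₛ Maybeₛ
      h = record
        { to        = f.to
        ; cong      = f.cong
        ; bijective = f.injective , λ y →
            let x , fx≈y = Maybe-injection-surjective f y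
            in x , λ z≈x → transₘ (f.cong z≈x) fx≈y
        }

    decide : (k : Func (ℕ∞ₛ ℓ) Maybeₛ) →
             (P → ∃[ x ] ∃[ p ] Func.to k x ≈ₘ just p) → Dec P
    decide k attained
      with omniscience (λ x≈y (p , eq) → p , transₘ (symₘ (k.cong x≈y)) eq) just?
      where
      module k = Func k

      just? : ∀ x → Dec (∃ λ p → k.to x ≈ₘ just p)
      just? x with k.to x
      ... | just p  = yes (p , reflₘ)
      ... | nothing = no λ { (_ , ()) }
    ... | yes (_ , p , _) = yes p
    ... | no none         = no (none ∘ attained)

    -- The disjoint sum.

    module Sum where

      X : Setoid ℓ ℓ
      X = Maybeₛ ⊎ₛ ℕ∞ₛ ℓ

      open Setoid X using () renaming (Carrier to |X|; _≈_ to _≈ˣ_)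

      A B : StableSubset X
      A = record
        { pred     = λ { (inj₁ _) → ⊥ ; (inj₂ x) → Even x }
        ; respects = λ { (⊎.inj₂ x≈y) → Even-resp x≈y }
        ; stable   = λ { (inj₁ _) ¬¬⊥ → contradiction (λ ()) ¬¬⊥
                       ; (inj₂ x) → Even-stable x }
        }
      B = record
        { pred     = λ { (inj₁ nothing) → ⊥ ; (inj₁ (just _)) → ⊤ ; (inj₂ x) → Even x }
        ; respects = λ { (⊎.inj₁ (Maybe.just _)) _ → tt ; (⊎.inj₂ x≈y) → Even-resp x≈y }
        ; stable   = λ { (inj₁ nothing) ¬¬⊥ → contradiction (λ ()) ¬¬⊥
                       ; (inj₁ (just _)) _ → tt
                       ; (inj₂ x) → Even-stable x }
        }

      -- Shifting by 2 preserves parity and frees one even and one odd number.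
      insert : (c : ℕ∞ ℓ) → (∀ x → ¬ c ≈ 1+ (1+ x)) → Injection X X
      insert c c≉2+ = record { to = to ; cong = to-cong ; injective = to-injective }
        where
        to : |X| → |X|
        to (inj₁ nothing)  = inj₁ nothing
        to (inj₁ (just _)) = inj₂ c
        to (inj₂ x)        = inj₂ (1+ (1+ x))

        to-cong : ∀ {x y} → x ≈ˣ y → to x ≈ˣ to y
        to-cong (⊎.inj₁ (Maybe.just _)) = ⊎.inj₂ ≈-refl
        to-cong (⊎.inj₁ Maybe.nothing)  = ⊎.inj₁ Maybe.nothing
        to-cong (⊎.inj₂ x≈y)            = ⊎.inj₂ (1+-cong (1+-cong x≈y))

        to-injective : ∀ {x y} → to x ≈ˣ to y → x ≈ˣ y
        to-injective {inj₁ nothing}  {inj₁ nothing}  _         = ⊎.inj₁ Maybe.nothing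
        to-injective {inj₁ (just _)} {inj₁ (just _)} _         = ⊎.inj₁ (Maybe.just tt)
        to-injective {inj₁ (just _)} {inj₂ y}        (⊎.inj₂ eq) = contradiction eq (c≉2+ y)
        to-injective {inj₂ x}        {inj₁ (just _)} (⊎.inj₂ eq) = contradiction (≈-sym eq) (c≉2+ x)
        to-injective {inj₂ x}        {inj₂ y}        (⊎.inj₂ eq) =
          ⊎.inj₂ (1+-injective (1+-injective eq))
        to-injective {inj₁ nothing}  {inj₁ (just _)} ()
        to-injective {inj₁ (just _)} {inj₁ nothing}  ()
        to-injective {inj₁ nothing}  {inj₂ y}        ()
        to-injective {inj₂ x}        {inj₁ nothing}  ()

      -- Points over `just` lie outside `A` and inside `B`, so f sends them to an odd number,
      -- outside `B`, and g sends them to an even one, inside `A`.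
      f g : Injection X X
      f = insert (fin 1) λ x eq → 1+∌0 (1+⁻ (⇒ eq fin∋))
      g = insert (fin 0) λ x eq → 1+∌0 (⇒ eq fin∋)

      dec : ¬¬Myhill X → Dec P
      dec myhill
        with h , h[A]⊆B , _ , surjective ← myhill A B f g
          ( (λ { {inj₁ nothing} () ; {inj₁ (just _)} () ; {inj₂ x} → Even-2+⁺ })
          , (λ { {inj₁ nothing} () ; {inj₁ (just _)} even → contradiction even ¬Even-fin1
               ; {inj₂ x} → Even-2+⁻ }))
          ( (λ { {inj₁ nothing} () ; {inj₁ (just _)} _ → Even-fin0 ; {inj₂ x} → Even-2+⁺ })
          , (λ { {inj₁ nothing} () ; {inj₁ (just _)} _ → tt ; {inj₂ x} → Even-2+⁻ }))
        = decide k attained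
        where
        left : Func X Maybeₛ
        left = record
          { to   = [ id , const nothing ]
          ; cong = λ { (⊎.inj₁ eq) → eq ; (⊎.inj₂ _) → Maybe.nothing }
          }

        k : Func (ℕ∞ₛ ℓ) Maybeₛ
        k = record
          { to   = λ x → Func.to left (Bijection.to h (inj₂ x))
          ; cong = λ x≈y → Func.cong left (Bijection.cong h (⊎.inj₂ x≈y))
          }

        attained : P → ∃[ x ] ∃[ p ] Func.to k x ≈ₘ just p
        attained p with surjective (inj₁ (just p) , tt)
        -- `A` is empty on the left summand, so the preimage found in `A` comes from ℕ∞.
        ... | (inj₂ x , even) , hx≈p = x , p , Func.cong left (hx≈p {inj₂ x , even} (⊎.inj₂ ≈-refl))

    -- The product.

    module Product where

      X : Setoid ℓ ℓ
      X = Maybeₛ ×ₛ ℕ∞ₛ ℓ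

      open Setoid X using () renaming (Carrier to |X|; _≈_ to _≈ˣ_)

      -- `A` is the column over `nothing`; `B` has in addition the point 0 of the column over
      -- `just`.
      A B : StableSubset X
      A = record
        { pred     = λ { (nothing , _) → ⊤ ; (just _ , _) → ⊥ }
        ; respects = λ { (Maybe.nothing , _) _ → tt }
        ; stable   = λ { (nothing , _) _ → tt ; (just _ , _) ¬¬⊥ → contradiction (λ ()) ¬¬⊥ }
        }
      B = record
        { pred     = λ { (nothing , _) → ⊤ ; (just _ , x) → x ∋ 0 }
        ; respects = λ { (Maybe.nothing , _) _ → tt ; (Maybe.just _ , x≈y) → ⇒ x≈y }
        ; stable   = λ { (nothing , _) _ → tt ; (just _ , x) → decidable-stable (x ∋? 0) }
        }

      f g : Injection X X
      f = record { to = to ; cong = to-cong ; injective = to-injective }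
        where
        to : |X| → |X|
        to (nothing , x) = nothing , x
        -- The shift moves this column off 0 and hence out of `B`.
        to (just p  , x) = just p , 1+ x

        to-cong : ∀ {x y} → x ≈ˣ y → to x ≈ˣ to y
        to-cong (Maybe.nothing , eq) = Maybe.nothing , eq
        to-cong (Maybe.just _  , eq) = Maybe.just tt , 1+-cong eq

        to-injective : ∀ {x y} → to x ≈ˣ to y → x ≈ˣ y
        to-injective {nothing , _} {nothing , _} (_ , eq) = Maybe.nothing , eq
        to-injective {just _ , _}  {just _ , _}  (_ , eq) = Maybe.just tt , 1+-injective eq
        to-injective {nothing , _} {just _ , _}  (() , _)
        to-injective {just _ , _}  {nothing , _} (() , _)
      g = record { to = to ; cong = to-cong ; injective = to-injective }
        where
        to : |X| → |X|
        -- The shift frees 0 over `nothing`, which receives the extra point of `B`.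
        to (nothing , x) = nothing , 1+ x
        to (just p  , x) with x ∋? 0
        ... | yes _ = nothing , fin 0
        ... | no  _ = just p , x

        to-cong : ∀ {x y} → x ≈ˣ y → to x ≈ˣ to y
        to-cong (Maybe.nothing , eq) = Maybe.nothing , 1+-cong eq
        to-cong {_ , x} {_ , y} (Maybe.just _ , eq) with x ∋? 0 | y ∋? 0
        ... | yes _  | yes _  = Maybe.nothing , ≈-refl
        ... | no  _  | no  _  = Maybe.just tt , eq
        ... | yes x₀ | no ¬y₀ = contradiction (⇒ eq x₀) ¬y₀
        ... | no ¬x₀ | yes y₀ = contradiction (⇐ eq y₀) ¬x₀

        to-injective : ∀ {x y} → to x ≈ˣ to y → x ≈ˣ y
        to-injective {nothing , x} {nothing , y} (_ , eq) = Maybe.nothing , 1+-injective eq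
        to-injective {just _ , x}  {just _ , y}  eq with x ∋? 0 | y ∋? 0 | eq
        ... | yes x₀ | yes y₀ | _      = Maybe.just tt , ≈-trans (∋⇒≈fin x₀) (≈-sym (∋⇒≈fin y₀))
        ... | no  _  | no  _  | _ , eq = Maybe.just tt , eq
        ... | yes _  | no  _  | () , _
        ... | no  _  | yes _  | () , _
        to-injective {nothing , x} {just _ , y}  eq with y ∋? 0 | eq
        ... | yes _ | _ , eq = contradiction (≈fin⇒∋ eq) 1+∌0
        ... | no  _ | () , _
        to-injective {just _ , x}  {nothing , y} eq with x ∋? 0 | eq
        ... | yes _ | _ , eq = contradiction (≈fin⇒∋ (≈-sym eq)) 1+∌0
        ... | no  _ | () , _

      open StableSubset

      B⊆g⁻¹[A] : ∀ z → pred B z → pred A (Injection.to g z)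
      B⊆g⁻¹[A] (nothing , x) _  = tt
      B⊆g⁻¹[A] (just _  , x) x₀ with x ∋? 0
      ... | yes _  = tt
      ... | no ¬x₀ = contradiction x₀ ¬x₀

      g⁻¹[A]⊆B : ∀ z → pred A (Injection.to g z) → pred B z
      g⁻¹[A]⊆B (nothing , x) _  = tt
      g⁻¹[A]⊆B (just _  , x) gz∈A with x ∋? 0
      ... | yes x₀ = x₀
      ... | no  _  with () ← gz∈A

      dec : ¬¬Myhill X → Dec P
      dec myhill
        with h , h[A]⊆B , _ , surjective ← myhill A B f g
          ( (λ { {nothing , _} _ → tt ; {just _ , _} () })
          , (λ { {nothing , _} _ → tt ; {just _ , _} p → contradiction p 1+∌0 }))
          ((λ {z} → B⊆g⁻¹[A] z) , (λ {z} → g⁻¹[A]⊆B z))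
        = decide k attained
        where
        k : Func (ℕ∞ₛ ℓ) Maybeₛ
        k = record
          { to   = λ x → proj₁ (Bijection.to h (nothing , x))
          ; cong = λ x≈y → proj₁ (Bijection.cong h (Maybe.nothing , x≈y))
          }

        attained : P → ∃[ x ] ∃[ p ] Func.to k x ≈ₘ just p
        attained p with surjective ((just p , fin 0) , fin∋)
        -- All of `A` lies over `nothing`, so the preimage is given by some x in ℕ∞.
        ... | ((nothing , x) , _) , hx≈p =
          x , p , proj₁ (hx≈p {(nothing , x) , tt} (Maybe.nothing , ≈-refl))

corollary63 : (ℓ : Level) →
    MarkovsPrinciple →
    ((A B : Setoid ℓ ℓ) → ¬¬StrongMyhill A → ¬¬StrongMyhill B →
    ¬¬Myhill (A ⊎ₛ B) ⊎ ¬¬Myhill (A ×ₛ B)) →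
    ExcludedMiddle ℓ
corollary63 ℓ mp closed {P} =
  [ Sum.dec P , Product.dec P ]
    (closed (Maybeₛ P) (ℕ∞ₛ ℓ) (Maybe-strongMyhill P) (ℕ∞-strongMyhill mp))
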